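{- For every integer $n\ge 3$ let $$\tau(n)=\min\{t(G)+i(G) : G \text{ is an oriented graph on } n \text{ vertices}\}.$$ The sequence $\tau(n)$ converges and $\tau:=\lim_{n\to\infty}\tau(n)=\frac19$. That is, every $n$-vertex oriented graph $G$ satisfies $t(G)+i(G)\ge \frac19-o_n(1)$, and this bound is tight.
   Context: An oriented graph is a directed graph with no loops and no multiple (parallel or anti-parallel) edges. For an oriented graph $G$, $t(G)$ (respectively $i(G)$) denotes the probability that a uniformly random set of $3$ vertices of $G$ induces a transitive triangle (respectively an independent set, i.e. spans no edges). -}

module Defs where

open import Data.Nat using (ℕ; zero; suc)
open import Data.Nat.Combinatorics using (_C_)
open import Data.Bool using (Bool; true; false; _∧_; _∨_; not)
open import Data.Fin using (Fin; _<_; _<?_)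
open import Data.List using (List; []; _∷_; length; filter; allFin; concatMap; map)
open import Data.Product using (_×_; _,_)
open import Data.Integer using (+_)
open import Data.Rational using (ℚ; 0ℚ; _/_)
open import Relation.Binary.PropositionalEquality using (_≡_)
open import Relation.Nullary.Decidable using (does)

record OrientedGraph (n : ℕ) : Set where
  field
    E       : Fin n → Fin n → Bool
    noLoop  : ∀ i → E i i ≡ false
    oriented : ∀ i j → E i j ≡ true → E j i ≡ false
open OrientedGraph public

threeSets : (n : ℕ) → List (Fin n × Fin n × Fin n)
threeSets n =
  concatMap (λ i → concatMap (λ j → map (λ k → (i , j , k))
      (filter (λ k → j <? k) (allFin n)))
    (filter (λ j → i <? j) (allFin n)))
  (allFin n)

transOrd : ∀ {n} → OrientedGraph n → Fin n → Fin n → Fin n → Bool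
transOrd G a b c = E G a b ∧ E G b c ∧ E G a c

isTransitive : ∀ {n} → OrientedGraph n → Fin n × Fin n × Fin n → Bool
isTransitive G (a , b , c) =
  transOrd G a b c ∨ transOrd G a c b ∨ transOrd G b a c ∨
  transOrd G b c a ∨ transOrd G c a b ∨ transOrd G c b a

adj : ∀ {n} → OrientedGraph n → Fin n → Fin n → Bool
adj G x y = E G x y ∨ E G y x

isIndependent : ∀ {n} → OrientedGraph n → Fin n × Fin n × Fin n → Bool
isIndependent G (a , b , c) = not (adj G a b ∨ adj G b c ∨ adj G a c)

-- a / b as a rational (0 if b = 0; only used with b = n C 3 > 0 for n ≥ 3)
ratio : ℕ → ℕ → ℚ
ratio a zero = 0ℚ
ratio a (suc b) = (+ a) / suc b

t : ∀ {n} → OrientedGraph n → ℚ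
t {n} G = ratio (length (filter (λ s → isTransitive G s Data.Bool.≟ true) (threeSets n))) (n C 3)

i : ∀ {n} → OrientedGraph n → ℚ
i {n} G = ratio (length (filter (λ s → isIndependent G s Data.Bool.≟ true) (threeSets n))) (n C 3)

one-ninth : ℚ
one-ninth = + 1 / 9

{-# OPTIONS --safe #-}
module Submission where

-- Work with ordered tuples of vertices, repetitions allowed, a vertex counting as
-- nonadjacent to itself; this changes the number of triples by O(n²). For each pair
-- (x , y) that is nonadjacent or an arc, a fixed nonnegative combination of squares
-- (∑ f (r x z) (r y z) over z)² is nonnegative. Expanded and summed over (x , y), these
-- squares become a sum over quadruples (x , y , z , w) whose symmetrisation depends only on the
-- six arcs among the four vertices, and in each of the 3⁶ cases it is at most the
-- corresponding count of transitive or independent triples minus its claimed average.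
-- Tightness comes from the balanced blow-up of the directed triangle.

open import Defs
open import Data.Bool as Bool using (Bool; true; false; _∧_; _∨_; not; if_then_else_)
open import Data.Fin as Fin using (Fin)
open import Data.Fin.Patterns
import Data.Fin.Properties as Fin
open import Data.Integer as ℤ using (ℤ; +_; -_; 0ℤ; 1ℤ)
import Data.Integer.Properties as ℤ
open import Algebra.Properties.Semiring.Sum ℤ.+-*-semiring
  using (sum; sum-syntax; sum-cong-≗; ∑-distrib-+; ∑-comm; *-distribˡ-sum; *-distribʳ-sum; sum-replicate-zero)
open import Data.Integer.Tactic.RingSolver using (solve-∀)
open import Data.List using (List; []; _∷_; foldr; _++_; map; concatMap; filter; allFin; tabulate; length)
open import Data.List.Relation.Unary.All using (All; []; _∷_)
open import Data.Nat as ℕ using (ℕ; zero; suc; _≤_)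
import Data.Nat.Combinatorics as ℕ
open import Data.Nat.Combinatorics using (_C_)
open import Data.Nat.Coprimality using (Coprime)
import Data.Nat.Properties as ℕ
open import Data.Nat.Tactic.RingSolver using () renaming (solve-∀ to solveℕ-∀)
open import Data.Product using (_×_; _,_; ∃-syntax; proj₁)
open import Data.Rational as ℚ using (ℚ; 0ℚ; _+_; _-_; _<_) renaming (_≤_ to _≤ℚ_)
import Data.Rational.Properties as ℚ
open import Data.Rational.Unnormalised as ℚᵘ using (mkℚᵘ; *≡*; *≤*)
import Data.Rational.Unnormalised.Properties as ℚᵘ
open import Function using (_∘_)
open import Relation.Binary.PropositionalEquality
  using (_≡_; refl; sym; trans; cong; cong₂; subst; subst₂; module ≡-Reasoning)
open import Relation.Nullary.Decidable using (Dec; does; yes; map′; _×-dec_; from-yes; dec-true; dec-false)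
open import Relation.Unary using (Decidable)

-- Arc patterns and the sum of squares

data Arc : Set where
  fwd non bwd : Arc

rev : Arc → Arc
rev fwd = bwd
rev non = non
rev bwd = fwd

∀Arc? : {P : Arc → Set} → (∀ a → Dec (P a)) → Dec (∀ a → P a)
∀Arc? P? = map′ (λ { (p , q , r) fwd → p ; (p , q , r) non → q ; (p , q , r) bwd → r })
                (λ f → f fwd , f non , f bwd)
                (P? fwd ×-dec P? non ×-dec P? bwd)

fwd? bwd? : Arc → Bool
fwd? fwd = true
fwd? _   = false
bwd? = fwd? ∘ rev

χ : Bool → ℤ
χ b = if b then 1ℤ else 0ℤ

-- The disjuncts come in the order of `isTransitive` and `isIndependent`, so `weight-arc` holds by
-- `refl` once the six Booleans are replaced by values of `fwd?` and `bwd?`.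
transitive independent : Bool → Bool → Bool → Bool → Bool → Bool → Bool
transitive xy yx yz zy xz zx =
  xy ∧ yz ∧ xz ∨ xz ∧ zy ∧ xy ∨ yx ∧ xz ∧ yz ∨
  yz ∧ zx ∧ yx ∨ zx ∧ xy ∧ zy ∨ zy ∧ yx ∧ zx
independent xy yx yz zy xz zx = not ((xy ∨ yx) ∨ (yz ∨ zy) ∨ (xz ∨ zx))

weight : Arc → Arc → Arc → ℤ
weight a b c = χ (transitive (fwd? a) (bwd? a) (fwd? b) (bwd? b) (fwd? c) (bwd? c))
     ℤ.+ χ (independent (fwd? a) (bwd? a) (fwd? b) (bwd? b) (fwd? c) (bwd? c))

weightAt : {A : Set} → (A → A → Arc) → A → A → A → ℤ
weightAt r x y z = weight (r x y) (r y z) (r x z)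

Feature : Set
Feature = Arc → Arc → ℤ

-- The features and their multipliers round a semidefinite optimum for 4-vertex
-- oriented graphs; the balanced blow-up of the directed triangle annihilates
-- every sum ∑ f (r x z) (r y z) over z.
f₁ f₂ f₃ f₄ g₁ g₂ g₃ : Feature
f₁ non non = + 2
f₁ fwd fwd = - (+ 1)
f₁ bwd bwd = - (+ 1)
f₁ _   _   = 0ℤ

f₂ fwd fwd = + 4
f₂ fwd non = + 3
f₂ non fwd = + 3
f₂ bwd bwd = - (+ 4)
f₂ bwd non = - (+ 3)
f₂ non bwd = - (+ 3)
f₂ _   _   = 0ℤ

f₃ fwd non = + 1
f₃ non fwd = + 1
f₃ bwd non = - (+ 1)
f₃ non bwd = - (+ 1)
f₃ _   _   = 0ℤ

f₄ fwd non = + 1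
f₄ bwd non = + 1
f₄ non fwd = - (+ 1)
f₄ non bwd = - (+ 1)
f₄ _   _   = 0ℤ

g₁ non non = + 6
g₁ non fwd = - (+ 3)
g₁ bwd non = - (+ 3)
g₁ fwd fwd = - (+ 7)
g₁ bwd bwd = - (+ 7)
g₁ _   _   = 0ℤ

g₂ fwd non = + 1
g₂ non bwd = - (+ 1)
g₂ fwd fwd = + 1
g₂ bwd bwd = - (+ 1)
g₂ _   _   = 0ℤ

g₃ non fwd = + 1
g₃ bwd non = - (+ 1)
g₃ _   _   = 0ℤ

-- An arc is counted once, from its tail, so the pair read backwards gets no squares. A nonadjacent
-- pair is counted in both orders.
squares : Arc → List (ℤ × Feature)
squares non = (+ 12 , f₁) ∷ (+ 3 , f₂) ∷ (+ 15 , f₃) ∷ (+ 27 , f₄) ∷ []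
squares fwd = (+ 2 , g₁) ∷ (+ 78 , g₂) ∷ (+ 36 , g₃) ∷ []
squares bwd = []

polar : List (ℤ × Feature) → Arc → Arc → Arc → Arc → ℤ
polar []             a b c d = 0ℤ
polar ((m , f) ∷ fs) a b c d = m ℤ.* (f a b ℤ.* f c d) ℤ.+ polar fs a b c d

module _ {A : Set} where

  infixl 6 _⊕_
  _⊕_ : (F G : A → A → A → A → ℤ) → A → A → A → A → ℤ
  (F ⊕ G) x y z w = F x y z w ℤ.+ G x y z w

  σ₁ σ₂ σ₃ : (A → A → A → A → ℤ) → A → A → A → A → ℤ
  σ₁ F x y z w = F y x z w
  σ₂ F x y z w = F x z y w
  σ₃ F x y z w = F x y w z

  -- The twelve terms put every ordered pair of the four arguments into the first two places of `F`.
  -- Since `form` and `density` are unchanged when `z` and `w` are swapped, these twelve stand for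
  -- all 24 permutations.
  symmetrise : (A → A → A → A → ℤ) → A → A → A → A → ℤ
  symmetrise F = G ⊕ σ₁ G ⊕ σ₂ (σ₁ G) ⊕ σ₃ (σ₂ (σ₁ G))
    where G = F ⊕ σ₂ F ⊕ σ₃ (σ₂ F)

module _ {A : Set} (r : A → A → Arc) where

  form density : A → A → A → A → ℤ
  form x y z w = polar (squares (r x y)) (r x z) (r y z) (r x w) (r y w)
  density x y z w = + 27 ℤ.* (weightAt r x y z ℤ.+ weightAt r x y w)

tableau : (xy xz xw yz yw zw : Arc) → Fin 4 → Fin 4 → Arc
tableau xy xz xw yz yw zw = entry
  where
  entry : Fin 4 → Fin 4 → Arc
  entry 0F 1F = xy
  entry 0F 2F = xz
  entry 0F 3F = xw
  entry 1F 2F = yz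
  entry 1F 3F = yw
  entry 2F 3F = zw
  entry 1F 0F = rev xy
  entry 2F 0F = rev xz
  entry 3F 0F = rev xw
  entry 2F 1F = rev yz
  entry 3F 1F = rev yw
  entry 3F 2F = rev zw
  entry _  _  = non

-- Each of the 12 terms of the right-hand side averages 54 times the mean weight, and 72 / (12 · 54) = 1/9.
form≤density-tableau : ∀ xy xz xw yz yw zw → let r = tableau xy xz xw yz yw zw in
  symmetrise (form r) 0F 1F 2F 3F ℤ.+ + 72 ℤ.≤ symmetrise (density r) 0F 1F 2F 3F
form≤density-tableau = from-yes
  (∀Arc? λ xy → ∀Arc? λ xz → ∀Arc? λ xw → ∀Arc? λ yz → ∀Arc? λ yw → ∀Arc? λ zw →
    let r = tableau xy xz xw yz yw zw in
    symmetrise (form r) 0F 1F 2F 3F ℤ.+ + 72 ℤ.≤? symmetrise (density r) 0F 1F 2F 3F)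

-- Both sides read `r` only at pairs of different argument positions. Antisymmetry expresses these
-- values by the six above the diagonal, which the tableau lets vary freely, so coinciding points
-- are covered as well.
form≤density : {A : Set} (r : A → A → Arc) → (∀ x y → r y x ≡ rev (r x y)) → ∀ x y z w →
  symmetrise (form r) x y z w ℤ.+ + 72 ℤ.≤ symmetrise (density r) x y z w
form≤density r anti x y z w
  rewrite anti x y | anti x z | anti x w | anti y z | anti y w | anti z w
  = form≤density-tableau (r x y) (r x z) (r x w) (r y z) (r y w) (r z w)

-- Sums over tuples

∑-mono : ∀ {n} {f g : Fin n → ℤ} → (∀ x → f x ℤ.≤ g x) → sum f ℤ.≤ sum g
∑-mono {zero}  f≤g = ℤ.≤-refl
∑-mono {suc n} f≤g = ℤ.+-mono-≤ (f≤g 0F) (∑-mono (f≤g ∘ Fin.suc))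

∑-const : ∀ n c → ∑[ x < n ] c ≡ + n ℤ.* c
∑-const zero    c = sym (ℤ.*-zeroˡ c)
∑-const (suc n) c = begin
  c ℤ.+ ∑[ x < n ] c        ≡⟨ cong (ℤ._+_ c) (∑-const n c) ⟩
  c ℤ.+ + n ℤ.* c           ≡⟨ ℤ.suc-* (+ n) c ⟨
  + suc n ℤ.* c             ∎
  where open ≡-Reasoning

∑-nonneg : ∀ {n} {f : Fin n → ℤ} → (∀ x → 0ℤ ℤ.≤ f x) → 0ℤ ℤ.≤ sum f
∑-nonneg {zero}  0≤f = ℤ.≤-refl
∑-nonneg {suc n} 0≤f = ℤ.+-mono-≤ (0≤f 0F) (∑-nonneg (0≤f ∘ Fin.suc))

0≤i*i : ∀ i → 0ℤ ℤ.≤ i ℤ.* i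
0≤i*i (+ n)         = ℤ.≤-trans (ℤ.+≤+ ℕ.z≤n) (ℤ.≤-reflexive (ℤ.pos-* n n))
0≤i*i (ℤ.-[1+ n ]) = ℤ.+≤+ ℕ.z≤n

-- In each summand of `polar` the variables `z` and `w` separate, so its double sum is `m` times the
-- square of the sum of `f (p z) (q z)` over `z`.
∑-polar-nonneg : ∀ {n} fs → All (λ mf → 0ℤ ℤ.≤ proj₁ mf) fs → (p q : Fin n → Arc) →
  0ℤ ℤ.≤ ∑[ z < n ] ∑[ w < n ] polar fs (p z) (q z) (p w) (q w)
∑-polar-nonneg {n} [] [] p q = ∑-nonneg {n} λ z → ∑-nonneg {n} λ w → ℤ.≤-refl
∑-polar-nonneg {n} ((m , f) ∷ fs) (0≤m ∷ 0≤ms) p q = begin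
  0ℤ ℤ.+ 0ℤ
    ≤⟨ ℤ.+-mono-≤ (0≤m*i {m} 0≤m (0≤i*i (sum v))) (∑-polar-nonneg fs 0≤ms p q) ⟩
  m ℤ.* (sum v ℤ.* sum v) ℤ.+ ∑[ z < n ] ∑[ w < n ] rest z w
    ≡⟨ cong (ℤ._+ ∑[ z < n ] sum (rest z)) square ⟩
  (∑[ z < n ] ∑[ w < n ] (m ℤ.* (v z ℤ.* v w))) ℤ.+ ∑[ z < n ] ∑[ w < n ] rest z w
    ≡⟨ trans (sum-cong-≗ λ z → ∑-distrib-+ (λ w → m ℤ.* (v z ℤ.* v w)) (rest z))
             (∑-distrib-+ (λ z → ∑[ w < n ] (m ℤ.* (v z ℤ.* v w))) (λ z → sum (rest z))) ⟨
  ∑[ z < n ] ∑[ w < n ] polar ((m , f) ∷ fs) (p z) (q z) (p w) (q w) ∎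
  where
  open ℤ.≤-Reasoning
  0≤m*i : ∀ {m i} → 0ℤ ℤ.≤ m → 0ℤ ℤ.≤ i → 0ℤ ℤ.≤ m ℤ.* i
  0≤m*i {m} 0≤m 0≤i = ℤ.≤-trans (ℤ.≤-reflexive (sym (ℤ.*-zeroʳ m))) (ℤ.*-monoˡ-≤-nonNeg m {{ℤ.nonNegative 0≤m}} 0≤i)
  v : Fin n → ℤ
  v z = f (p z) (q z)
  rest : Fin n → Fin n → ℤ
  rest z w = polar fs (p z) (q z) (p w) (q w)
  square : m ℤ.* (sum v ℤ.* sum v) ≡ ∑[ z < n ] ∑[ w < n ] (m ℤ.* (v z ℤ.* v w))
  square = trans (cong (m ℤ.*_) (*-distribʳ-sum (sum v) v))
    (trans (*-distribˡ-sum m (λ z → v z ℤ.* sum v))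
      (sum-cong-≗ λ z → trans (cong (m ℤ.*_) (*-distribˡ-sum (v z) v))
                              (*-distribˡ-sum m (λ w → v z ℤ.* v w))))

∑₃ : ∀ {n} → (Fin n → Fin n → Fin n → ℤ) → ℤ
∑₃ F = sum λ x → sum λ y → sum (F x y)

∑₄ : ∀ {n} → (Fin n → Fin n → Fin n → Fin n → ℤ) → ℤ
∑₄ F = sum λ x → ∑₃ (F x)

∑₃-cong : ∀ {n} {F G : Fin n → Fin n → Fin n → ℤ} → (∀ x y z → F x y z ≡ G x y z) → ∑₃ F ≡ ∑₃ G
∑₃-cong F≡G = sum-cong-≗ λ x → sum-cong-≗ λ y → sum-cong-≗ (F≡G x y)

∑₃-mono : ∀ {n} {F G : Fin n → Fin n → Fin n → ℤ} → (∀ x y z → F x y z ℤ.≤ G x y z) → ∑₃ F ℤ.≤ ∑₃ G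
∑₃-mono F≤G = ∑-mono λ x → ∑-mono λ y → ∑-mono (F≤G x y)

∑₃-+ : ∀ {n} (F G : Fin n → Fin n → Fin n → ℤ) → ∑₃ (λ x y z → F x y z ℤ.+ G x y z) ≡ ∑₃ F ℤ.+ ∑₃ G
∑₃-+ F G = trans
  (sum-cong-≗ λ x → trans (sum-cong-≗ λ y → ∑-distrib-+ (F x y) (G x y)) (∑-distrib-+ _ (λ y → sum (G x y))))
  (∑-distrib-+ _ λ x → sum λ y → sum (G x y))

∑₃-const : ∀ n c → ∑₃ {n} (λ _ _ _ → c) ≡ + n ℤ.* (+ n ℤ.* (+ n ℤ.* c))
∑₃-const n c = trans
  (sum-cong-≗ {n} λ x → trans (sum-cong-≗ {n} λ y → ∑-const n c) (∑-const n (+ n ℤ.* c)))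
  (∑-const n (+ n ℤ.* (+ n ℤ.* c)))

∑₄-+ : ∀ {n} (F G : Fin n → Fin n → Fin n → Fin n → ℤ) → ∑₄ (F ⊕ G) ≡ ∑₄ F ℤ.+ ∑₄ G
∑₄-+ F G = trans (sum-cong-≗ λ x → ∑₃-+ (F x) (G x)) (∑-distrib-+ _ (∑₃ ∘ G))

∑₄-σ₁ : ∀ {n} (F : Fin n → Fin n → Fin n → Fin n → ℤ) → ∑₄ (σ₁ F) ≡ ∑₄ F
∑₄-σ₁ F = ∑-comm λ x y → sum λ z → sum (F y x z)

∑₄-σ₂ : ∀ {n} (F : Fin n → Fin n → Fin n → Fin n → ℤ) → ∑₄ (σ₂ F) ≡ ∑₄ F
∑₄-σ₂ F = sum-cong-≗ λ x → ∑-comm λ y z → sum (F x z y)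

∑₄-σ₃ : ∀ {n} (F : Fin n → Fin n → Fin n → Fin n → ℤ) → ∑₄ (σ₃ F) ≡ ∑₄ F
∑₄-σ₃ F = sum-cong-≗ λ x → sum-cong-≗ λ y → ∑-comm λ z w → F x y w z

∑₄-symmetrise : ∀ {n} (F : Fin n → Fin n → Fin n → Fin n → ℤ) → ∑₄ (symmetrise F) ≡ + 12 ℤ.* ∑₄ F
∑₄-symmetrise F = begin
  ∑₄ (symmetrise F)
    ≡⟨ trans (∑₄-+ _ (σ₃ (σ₂ (σ₁ G)))) (cong (ℤ._+ ∑₄ (σ₃ (σ₂ (σ₁ G))))
         (trans (∑₄-+ _ (σ₂ (σ₁ G))) (cong (ℤ._+ ∑₄ (σ₂ (σ₁ G))) (∑₄-+ G (σ₁ G))))) ⟩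
  ∑₄ G ℤ.+ ∑₄ (σ₁ G) ℤ.+ ∑₄ (σ₂ (σ₁ G)) ℤ.+ ∑₄ (σ₃ (σ₂ (σ₁ G)))
    ≡⟨ cong₂ ℤ._+_ (cong₂ ℤ._+_ (cong (ℤ._+_ (∑₄ G)) s₁) s₂) s₃ ⟩
  ∑₄ G ℤ.+ ∑₄ G ℤ.+ ∑₄ G ℤ.+ ∑₄ G
    ≡⟨ cong (λ g → g ℤ.+ g ℤ.+ g ℤ.+ g) ∑G ⟩
  _ ≡⟨ collect (∑₄ F) ⟩
  + 12 ℤ.* ∑₄ F ∎
  where
  open ≡-Reasoning
  G = F ⊕ σ₂ F ⊕ σ₃ (σ₂ F)
  s₁ = ∑₄-σ₁ G
  s₂ = trans (∑₄-σ₂ (σ₁ G)) s₁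
  s₃ = trans (∑₄-σ₃ (σ₂ (σ₁ G))) s₂
  ∑G : ∑₄ G ≡ ∑₄ F ℤ.+ ∑₄ F ℤ.+ ∑₄ F
  ∑G = trans (∑₄-+ _ (σ₃ (σ₂ F))) (cong₂ ℤ._+_
    (trans (∑₄-+ F (σ₂ F)) (cong (ℤ._+_ (∑₄ F)) (∑₄-σ₂ F)))
    (trans (∑₄-σ₃ (σ₂ F)) (∑₄-σ₂ F)))
  collect : ∀ s → (s ℤ.+ s ℤ.+ s) ℤ.+ (s ℤ.+ s ℤ.+ s) ℤ.+ (s ℤ.+ s ℤ.+ s) ℤ.+ (s ℤ.+ s ℤ.+ s) ≡ + 12 ℤ.* s
  collect = solve-∀

-- The lower bound for ordered triples

∑-weight : ∀ {n} → (Fin n → Fin n → Arc) → ℤ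
∑-weight r = ∑₃ (weightAt r)

∑-form-nonneg : ∀ {n} (r : Fin n → Fin n → Arc) → 0ℤ ℤ.≤ ∑₄ (form r)
∑-form-nonneg r = ∑-nonneg λ x → ∑-nonneg λ y →
  ∑-polar-nonneg (squares (r x y)) (multipliers (r x y)) (r x) (r y)
  where
  0≤+ : ∀ {m} → 0ℤ ℤ.≤ + m
  0≤+ = ℤ.+≤+ ℕ.z≤n
  multipliers : ∀ a → All (λ mf → 0ℤ ℤ.≤ proj₁ mf) (squares a)
  multipliers fwd = 0≤+ ∷ 0≤+ ∷ 0≤+ ∷ []
  multipliers non = 0≤+ ∷ 0≤+ ∷ 0≤+ ∷ 0≤+ ∷ []
  multipliers bwd = []

-- Each of the two weights in `density` ignores one of `z` and `w`. Summing over the ignored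
-- variable gives a factor `n`, and 27 + 27 = 54.
∑-density : ∀ {n} (r : Fin n → Fin n → Arc) → ∑₄ (density r) ≡ + n ℤ.* (+ 54 ℤ.* ∑-weight r)
∑-density {n} r = begin
  ∑₄ (density r)
    ≡⟨ sum-cong-≗ (λ x → sum-cong-≗ λ y → slice x y) ⟩
  ∑[ x < n ] ∑[ y < n ] (k ℤ.* ∑[ z < n ] W x y z)
    ≡⟨ trans (*-distribˡ-sum k (λ x → ∑[ y < n ] ∑[ z < n ] W x y z))
             (sum-cong-≗ λ x → *-distribˡ-sum k (λ y → ∑[ z < n ] W x y z)) ⟨
  k ℤ.* ∑-weight r
    ≡⟨ ℤ.*-assoc (+ n) (+ 54) _ ⟩
  + n ℤ.* (+ 54 ℤ.* ∑-weight r) ∎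
  where
  open ≡-Reasoning
  k = + n ℤ.* + 54
  W : Fin n → Fin n → Fin n → ℤ
  W = weightAt r
  double : ∀ m s → + 27 ℤ.* (m ℤ.* s ℤ.+ m ℤ.* s) ≡ m ℤ.* + 54 ℤ.* s
  double = solve-∀
  slice : ∀ x y → ∑[ z < n ] ∑[ w < n ] density r x y z w ≡ k ℤ.* ∑[ z < n ] W x y z
  slice x y = begin
    ∑[ z < n ] ∑[ w < n ] (+ 27 ℤ.* (W x y z ℤ.+ W x y w))
      ≡⟨ trans (*-distribˡ-sum (+ 27) (λ z → ∑[ w < n ] (W x y z ℤ.+ W x y w)))
           (sum-cong-≗ λ z → *-distribˡ-sum (+ 27) (λ w → W x y z ℤ.+ W x y w)) ⟨
    + 27 ℤ.* (∑[ z < n ] ∑[ w < n ] (W x y z ℤ.+ W x y w))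
      ≡⟨ cong (+ 27 ℤ.*_) (trans (sum-cong-≗ λ z →
           trans (∑-distrib-+ (λ _ → W x y z) (W x y)) (cong (ℤ._+ S) (∑-const n (W x y z))))
           (∑-distrib-+ (λ z → + n ℤ.* W x y z) (λ _ → S))) ⟩
    + 27 ℤ.* (∑[ z < n ] (+ n ℤ.* W x y z) ℤ.+ ∑[ z < n ] S)
      ≡⟨ cong (+ 27 ℤ.*_) (cong₂ ℤ._+_ (sym (*-distribˡ-sum (+ n) (W x y))) (∑-const n S)) ⟩
    + 27 ℤ.* (+ n ℤ.* S ℤ.+ + n ℤ.* S)
      ≡⟨ double (+ n) S ⟩
    k ℤ.* S ∎
    where S = ∑[ z < n ] W x y z

-- Summing `form≤density` over all quadruples and discarding the nonnegative squares gives 72n⁴ ≤ 12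
-- · 54n · `∑-weight r`; then 72n is cancelled. There is no error term, because tuples with
-- repetitions satisfy the pointwise inequality too.
n³≤9∑-weight : ∀ {n} (r : Fin n → Fin n → Arc) → (∀ x y → r y x ≡ rev (r x y)) →
  + n ℤ.* (+ n ℤ.* + n) ℤ.≤ + 9 ℤ.* ∑-weight r
n³≤9∑-weight {zero} r anti = ℤ.≤-refl
n³≤9∑-weight {n@(suc _)} r anti = ℤ.*-cancelˡ-≤-pos _ _ (+ n ℤ.* + 72) (begin
  + n ℤ.* + 72 ℤ.* (+ n ℤ.* (+ n ℤ.* + n))
    ≡⟨ shuffle (+ n) ⟩
  + 12 ℤ.* 0ℤ ℤ.+ + n ℤ.* (+ n ℤ.* (+ n ℤ.* (+ n ℤ.* + 72)))
    ≤⟨ ℤ.+-monoˡ-≤ _ (ℤ.*-monoˡ-≤-nonNeg (+ 12) (∑-form-nonneg r)) ⟩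
  + 12 ℤ.* ∑₄ (form r) ℤ.+ + n ℤ.* (+ n ℤ.* (+ n ℤ.* (+ n ℤ.* + 72)))
    ≡⟨ cong₂ ℤ._+_ (∑₄-symmetrise (form r))
         (trans (sum-cong-≗ {n} λ x → ∑₃-const n (+ 72)) (∑-const n (+ n ℤ.* (+ n ℤ.* (+ n ℤ.* + 72))))) ⟨
  ∑₄ (symmetrise (form r)) ℤ.+ ∑₄ {n} (λ _ _ _ _ → + 72)
    ≡⟨ ∑₄-+ (symmetrise (form r)) (λ _ _ _ _ → + 72) ⟨
  ∑₄ (symmetrise (form r) ⊕ λ _ _ _ _ → + 72)
    ≤⟨ ∑-mono (λ x → ∑₃-mono (form≤density r anti x)) ⟩
  ∑₄ (symmetrise (density r))
    ≡⟨ trans (∑₄-symmetrise (density r)) (cong (+ 12 ℤ.*_) (∑-density r)) ⟩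
  + 12 ℤ.* (+ n ℤ.* (+ 54 ℤ.* ∑-weight r))
    ≡⟨ regroup (+ n) (∑-weight r) ⟩
  + n ℤ.* + 72 ℤ.* (+ 9 ℤ.* ∑-weight r) ∎)
  where
  open ℤ.≤-Reasoning
  shuffle : ∀ m → m ℤ.* + 72 ℤ.* (m ℤ.* (m ℤ.* m)) ≡ + 12 ℤ.* 0ℤ ℤ.+ m ℤ.* (m ℤ.* (m ℤ.* (m ℤ.* + 72)))
  shuffle = solve-∀
  regroup : ∀ m s → + 12 ℤ.* (m ℤ.* (+ 54 ℤ.* s)) ≡ m ℤ.* + 72 ℤ.* (+ 9 ℤ.* s)
  regroup = solve-∀

-- Counting 3-sets by ordered triples

∑ₗ : {A : Set} → (A → ℤ) → List A → ℤ
∑ₗ h = foldr (λ x s → h x ℤ.+ s) 0ℤ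

module _ {A : Set} (h : A → ℤ) where

  ∑ₗ-++ : ∀ xs ys → ∑ₗ h (xs ++ ys) ≡ ∑ₗ h xs ℤ.+ ∑ₗ h ys
  ∑ₗ-++ []       ys = sym (ℤ.+-identityˡ _)
  ∑ₗ-++ (x ∷ xs) ys = trans (cong (ℤ._+_ (h x)) (∑ₗ-++ xs ys)) (sym (ℤ.+-assoc (h x) _ _))

  ∑ₗ-map : {B : Set} (g : B → A) → ∀ xs → ∑ₗ h (map g xs) ≡ ∑ₗ (h ∘ g) xs
  ∑ₗ-map g []       = refl
  ∑ₗ-map g (x ∷ xs) = cong (ℤ._+_ (h (g x))) (∑ₗ-map g xs)

  ∑ₗ-concatMap : {B : Set} (g : B → List A) → ∀ xs → ∑ₗ h (concatMap g xs) ≡ ∑ₗ (∑ₗ h ∘ g) xs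
  ∑ₗ-concatMap g []       = refl
  ∑ₗ-concatMap g (x ∷ xs) =
    trans (∑ₗ-++ (g x) (concatMap g xs)) (cong (ℤ._+_ (∑ₗ h (g x))) (∑ₗ-concatMap g xs))

  ∑ₗ-filter : {P : A → Set} (P? : Decidable P) → ∀ xs →
    ∑ₗ h (filter P? xs) ≡ ∑ₗ (λ x → χ (does (P? x)) ℤ.* h x) xs
  ∑ₗ-filter P? []       = refl
  ∑ₗ-filter P? (x ∷ xs) with does (P? x)
  ... | true  = cong₂ ℤ._+_ (sym (ℤ.*-identityˡ (h x))) (∑ₗ-filter P? xs)
  ... | false = trans (∑ₗ-filter P? xs) (sym (ℤ.+-identityˡ _))

  ∑ₗ-tabulate : ∀ {n} (g : Fin n → A) → ∑ₗ h (tabulate g) ≡ sum (h ∘ g)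
  ∑ₗ-tabulate {zero}  g = refl
  ∑ₗ-tabulate {suc n} g = cong (ℤ._+_ (h (g 0F))) (∑ₗ-tabulate (g ∘ Fin.suc))

length-filter : {A : Set} (f : A → Bool) → ∀ xs →
  + length (filter (λ x → f x Bool.≟ true) xs) ≡ ∑ₗ (χ ∘ f) xs
length-filter f []       = refl
length-filter f (x ∷ xs) with f x
... | true  = cong (ℤ._+_ 1ℤ) (length-filter f xs)
... | false = trans (length-filter f xs) (sym (ℤ.+-identityˡ _))

∑ₗ-+ : {A : Set} (g h : A → ℤ) → ∀ xs → ∑ₗ g xs ℤ.+ ∑ₗ h xs ≡ ∑ₗ (λ x → g x ℤ.+ h x) xs
∑ₗ-+ g h []       = refl
∑ₗ-+ g h (x ∷ xs) = trans (interchange (g x) (∑ₗ g xs) (h x) (∑ₗ h xs)) (cong (ℤ._+_ (g x ℤ.+ h x)) (∑ₗ-+ g h xs))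
  where
  interchange : ∀ a b c d → a ℤ.+ b ℤ.+ (c ℤ.+ d) ≡ a ℤ.+ c ℤ.+ (b ℤ.+ d)
  interchange = solve-∀

∑ₗ-filter-allFin : ∀ {n} (h : Fin n → ℤ) {P : Fin n → Set} (P? : Decidable P) →
  ∑ₗ h (filter P? (allFin n)) ≡ ∑[ x < n ] (χ (does (P? x)) ℤ.* h x)
∑ₗ-filter-allFin {n} h P? =
  trans (∑ₗ-filter h P? (allFin n)) (∑ₗ-tabulate (λ x → χ (does (P? x)) ℤ.* h x) (λ x → x))

∑-threeSets : ∀ n (h : Fin n × Fin n × Fin n → ℤ) → ∑ₗ h (threeSets n) ≡
  ∑₃ λ x y z → χ (does (x Fin.<? y)) ℤ.* (χ (does (y Fin.<? z)) ℤ.* h (x , y , z))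
∑-threeSets n h =
  trans (∑ₗ-concatMap h triplesFrom (allFin n))
  (trans (∑ₗ-tabulate (∑ₗ h ∘ triplesFrom) (λ x → x)) (sum-cong-≗ λ x →
  trans (∑ₗ-concatMap h (triplesVia x) (filter (x Fin.<?_) (allFin n)))
  (trans (∑ₗ-filter-allFin (∑ₗ h ∘ triplesVia x) (x Fin.<?_)) (sum-cong-≗ λ y →
  trans (cong (χ (does (x Fin.<? y)) ℤ.*_)
    (trans (∑ₗ-map h (λ z → x , y , z) (filter (y Fin.<?_) (allFin n)))
           (∑ₗ-filter-allFin (λ z → h (x , y , z)) (y Fin.<?_))))
    (*-distribˡ-sum (χ (does (x Fin.<? y))) (λ z → χ (does (y Fin.<? z)) ℤ.* h (x , y , z)))))))
  where
  triplesVia : Fin n → Fin n → List (Fin n × Fin n × Fin n)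
  triplesVia x y = map (λ z → x , y , z) (filter (y Fin.<?_) (allFin n))
  triplesFrom : Fin n → List (Fin n × Fin n × Fin n)
  triplesFrom x = concatMap (triplesVia x) (filter (x Fin.<?_) (allFin n))

-- Two opposite arcs default to `fwd`, which keeps `fwd?-arcOf` unconditional. The hypothesis of
-- `rev-arcOf` excludes this case.
arcOf : Bool → Bool → Arc
arcOf true  _     = fwd
arcOf false true  = bwd
arcOf false false = non

fwd?-arcOf : ∀ b c → b ≡ fwd? (arcOf b c)
fwd?-arcOf true  c     = refl
fwd?-arcOf false true  = refl
fwd?-arcOf false false = refl

rev-arcOf : ∀ b c → (b ≡ true → c ≡ false) → arcOf c b ≡ rev (arcOf b c)
rev-arcOf false false _ = refl
rev-arcOf false true  _ = refl
rev-arcOf true  false _ = refl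
rev-arcOf true  true  b⇒¬c with () ← b⇒¬c refl

arc : ∀ {n} → OrientedGraph n → Fin n → Fin n → Arc
arc G x y = arcOf (E G x y) (E G y x)

arc-rev : ∀ {n} (G : OrientedGraph n) x y → arc G y x ≡ rev (arc G x y)
arc-rev G x y = rev-arcOf (E G x y) (E G y x) (oriented G x y)

witness : ∀ {P : Set} (p? : Dec P) → does p? ≡ true → P
witness (yes p) _ = p

-- Coding the vertex order as an arc pattern lets one finite check range over the order and the
-- graph on three points together.
order : ∀ {n} → Fin n → Fin n → Arc
order x y = arcOf (does (x Fin.<? y)) (does (y Fin.<? x))

fwd?-order : ∀ {n} (x y : Fin n) → does (x Fin.<? y) ≡ fwd? (order x y)
fwd?-order x y = fwd?-arcOf (does (x Fin.<? y)) (does (y Fin.<? x))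

order-rev : ∀ {n} (x y : Fin n) → order y x ≡ rev (order x y)
order-rev x y = rev-arcOf (does (x Fin.<? y)) (does (y Fin.<? x)) asym
  where
  asym : does (x Fin.<? y) ≡ true → does (y Fin.<? x) ≡ false
  asym x<?y = dec-false (y Fin.<? x) (Fin.<-asym (witness (x Fin.<? y) x<?y))

badTriples : ∀ {n} → OrientedGraph n → ℕ
badTriples {n} G =
  length (filter (λ s → isTransitive G s Bool.≟ true) (threeSets n)) ℕ.+
  length (filter (λ s → isIndependent G s Bool.≟ true) (threeSets n))

weight-arc : ∀ {n} (G : OrientedGraph n) x y z →
  χ (isTransitive G (x , y , z)) ℤ.+ χ (isIndependent G (x , y , z)) ≡
  weight (arc G x y) (arc G y z) (arc G x z)
weight-arc G x y z = arcs _ _ _ (to x y) (from x y) (to y z) (from y z) (to x z) (from x z)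
  where
  to : ∀ x y → E G x y ≡ fwd? (arc G x y)
  to x y = fwd?-arcOf (E G x y) (E G y x)
  from : ∀ x y → E G y x ≡ bwd? (arc G x y)
  from x y = trans (to y x) (cong fwd? (arc-rev G x y))
  arcs : ∀ a b c {xy yx yz zy xz zx} →
    xy ≡ fwd? a → yx ≡ bwd? a → yz ≡ fwd? b → zy ≡ bwd? b → xz ≡ fwd? c → zx ≡ bwd? c →
    χ (transitive xy yx yz zy xz zx) ℤ.+ χ (independent xy yx yz zy xz zx) ≡ weight a b c
  arcs a b c refl refl refl refl refl refl = refl

module _ {A : Set} where

  τ₁ τ₂ symmetrise₃ : (A → A → A → ℤ) → A → A → A → ℤ
  τ₁ F x y z = F y x z
  τ₂ F x y z = F x z y
  symmetrise₃ F x y z = H x y z ℤ.+ τ₁ H x y z ℤ.+ τ₂ (τ₁ H) x y z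
    where
    H : A → A → A → ℤ
    H x y z = F x y z ℤ.+ τ₂ F x y z

∑₃-τ₁ : ∀ {n} (F : Fin n → Fin n → Fin n → ℤ) → ∑₃ (τ₁ F) ≡ ∑₃ F
∑₃-τ₁ F = ∑-comm λ x y → sum (F y x)

∑₃-τ₂ : ∀ {n} (F : Fin n → Fin n → Fin n → ℤ) → ∑₃ (τ₂ F) ≡ ∑₃ F
∑₃-τ₂ F = sum-cong-≗ λ x → ∑-comm λ y z → F x z y

∑₃-symmetrise₃ : ∀ {n} (F : Fin n → Fin n → Fin n → ℤ) → ∑₃ (symmetrise₃ F) ≡ + 6 ℤ.* ∑₃ F
∑₃-symmetrise₃ {n} F = begin
  ∑₃ (symmetrise₃ F)
    ≡⟨ trans (∑₃-+ (λ x y z → H x y z ℤ.+ τ₁ H x y z) (τ₂ (τ₁ H))) (cong (ℤ._+ ∑₃ (τ₂ (τ₁ H))) (∑₃-+ H (τ₁ H))) ⟩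
  ∑₃ H ℤ.+ ∑₃ (τ₁ H) ℤ.+ ∑₃ (τ₂ (τ₁ H))
    ≡⟨ cong₂ ℤ._+_ (cong (ℤ._+_ (∑₃ H)) (∑₃-τ₁ H)) (trans (∑₃-τ₂ (τ₁ H)) (∑₃-τ₁ H)) ⟩
  ∑₃ H ℤ.+ ∑₃ H ℤ.+ ∑₃ H
    ≡⟨ cong (λ s → s ℤ.+ s ℤ.+ s) (trans (∑₃-+ F (τ₂ F)) (cong (ℤ._+_ (∑₃ F)) (∑₃-τ₂ F))) ⟩
  _ ≡⟨ collect (∑₃ F) ⟩
  + 6 ℤ.* ∑₃ F ∎
  where
  open ≡-Reasoning
  H : Fin n → Fin n → Fin n → ℤ
  H x y z = F x y z ℤ.+ τ₂ F x y z
  collect : ∀ s → (s ℤ.+ s) ℤ.+ (s ℤ.+ s) ℤ.+ (s ℤ.+ s) ≡ + 6 ℤ.* s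
  collect = solve-∀

-- Applied to `order x y`, this is the indicator of `x` and `y` being equal.
tie : Arc → ℤ
tie a = χ (not (fwd? a ∨ bwd? a))

module _ {A : Set} (o r : A → A → Arc) where

  -- The two agree when o is transitive. For arbitrary antisymmetric o, which may be
  -- cyclic, increasing₂ suits the lower bound on its symmetrisation and increasing₃ the upper.
  increasing₂ increasing₃ : A → A → A → ℤ
  increasing₂ x y z = χ (fwd? (o x y)) ℤ.* (χ (fwd? (o y z)) ℤ.* weightAt r x y z)
  increasing₃ x y z = χ (fwd? (o x y)) ℤ.* (χ (fwd? (o y z)) ℤ.* (χ (fwd? (o x z)) ℤ.* weightAt r x y z))

-- A weight is at most 1, so a single tie already pays for it. Without ties some arrangement of the
-- three points has both consecutive pairs forward in `o`, even when `o` is cyclic, and the weight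
-- is the same for all six arrangements.
weight≤increasing-tableau : ∀ xy xz yz xy′ xz′ yz′ →
  let o = tableau xy xz non yz non non
      r = tableau xy′ xz′ non yz′ non non in
  weightAt r 0F 1F 2F ℤ.≤
    symmetrise₃ (increasing₂ o r) 0F 1F 2F ℤ.+ (tie (o 0F 1F) ℤ.+ tie (o 1F 2F) ℤ.+ tie (o 0F 2F))
weight≤increasing-tableau = from-yes
  (∀Arc? λ xy → ∀Arc? λ xz → ∀Arc? λ yz → ∀Arc? λ xy′ → ∀Arc? λ xz′ → ∀Arc? λ yz′ →
    let o = tableau xy xz non yz non non
        r = tableau xy′ xz′ non yz′ non non in
    weightAt r 0F 1F 2F ℤ.≤?
      symmetrise₃ (increasing₂ o r) 0F 1F 2F ℤ.+ (tie (o 0F 1F) ℤ.+ tie (o 1F 2F) ℤ.+ tie (o 0F 2F)))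

-- Three forward comparisons determine the arrangement, so at most one of the six terms survives; by
-- the symmetry of the weight it equals the right-hand side.
increasing≤weight-tableau : ∀ xy xz yz xy′ xz′ yz′ →
  let o = tableau xy xz non yz non non
      r = tableau xy′ xz′ non yz′ non non in
  symmetrise₃ (increasing₃ o r) 0F 1F 2F ℤ.≤ weightAt r 0F 1F 2F
increasing≤weight-tableau = from-yes
  (∀Arc? λ xy → ∀Arc? λ xz → ∀Arc? λ yz → ∀Arc? λ xy′ → ∀Arc? λ xz′ → ∀Arc? λ yz′ →
    let o = tableau xy xz non yz non non
        r = tableau xy′ xz′ non yz′ non non in
    symmetrise₃ (increasing₃ o r) 0F 1F 2F ℤ.≤? weightAt r 0F 1F 2F)

module _ {A : Set} (o r : A → A → Arc)
  (o-rev : ∀ x y → o y x ≡ rev (o x y)) (r-rev : ∀ x y → r y x ≡ rev (r x y)) where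

  weight≤increasing : ∀ x y z → weightAt r x y z ℤ.≤
    symmetrise₃ (increasing₂ o r) x y z ℤ.+ (tie (o x y) ℤ.+ tie (o y z) ℤ.+ tie (o x z))
  weight≤increasing x y z
    rewrite o-rev x y | o-rev x z | o-rev y z | r-rev x y | r-rev x z | r-rev y z
    = weight≤increasing-tableau (o x y) (o x z) (o y z) (r x y) (r x z) (r y z)

  increasing≤weight : ∀ x y z → symmetrise₃ (increasing₃ o r) x y z ℤ.≤ weightAt r x y z
  increasing≤weight x y z
    rewrite o-rev x y | o-rev x z | o-rev y z | r-rev x y | r-rev x z | r-rev y z
    = increasing≤weight-tableau (o x y) (o x z) (o y z) (r x y) (r x z) (r y z)

badTriples-∑ : ∀ {n} (G : OrientedGraph n) → + badTriples G ≡ ∑₃ (increasing₂ order (arc G))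
badTriples-∑ {n} G = begin
  + badTriples G
    ≡⟨ trans (ℤ.pos-+ (length (filter (λ s → isTransitive G s Bool.≟ true) (threeSets n))) _)
         (cong₂ ℤ._+_ (length-filter (isTransitive G) (threeSets n)) (length-filter (isIndependent G) (threeSets n))) ⟩
  ∑ₗ (χ ∘ isTransitive G) (threeSets n) ℤ.+ ∑ₗ (χ ∘ isIndependent G) (threeSets n)
    ≡⟨ ∑ₗ-+ (χ ∘ isTransitive G) (χ ∘ isIndependent G) (threeSets n) ⟩
  ∑ₗ bad (threeSets n)
    ≡⟨ ∑-threeSets n bad ⟩
  ∑₃ (λ x y z → χ (does (x Fin.<? y)) ℤ.* (χ (does (y Fin.<? z)) ℤ.* bad (x , y , z)))
    ≡⟨ ∑₃-cong (λ x y z → cong₂ ℤ._*_ (cong χ (fwd?-order x y))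
         (cong₂ ℤ._*_ (cong χ (fwd?-order y z)) (weight-arc G x y z))) ⟩
  ∑₃ (increasing₂ order (arc G)) ∎
  where
  open ≡-Reasoning
  bad : Fin n × Fin n × Fin n → ℤ
  bad s = χ (isTransitive G s) ℤ.+ χ (isIndependent G s)

increasing₂≡increasing₃ : ∀ {n} (r : Fin n → Fin n → Arc) x y z →
  increasing₂ order r x y z ≡ increasing₃ order r x y z
increasing₂≡increasing₃ r x y z = absorb _ _ _ chain
  where
  absorb : ∀ a b c {w} → (a ≡ true → b ≡ true → c ≡ true) →
    χ a ℤ.* (χ b ℤ.* w) ≡ χ a ℤ.* (χ b ℤ.* (χ c ℤ.* w))
  absorb false b     c ab⇒c = refl
  absorb true  false c ab⇒c = refl
  absorb true  true  c {w} ab⇒c with refl ← ab⇒c refl refl =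
    cong (λ v → 1ℤ ℤ.* (1ℤ ℤ.* v)) (sym (ℤ.*-identityˡ w))
  lift : ∀ x y → fwd? (order x y) ≡ true → x Fin.< y
  lift x y eq = witness (x Fin.<? y) (trans (fwd?-order x y) eq)
  chain : fwd? (order x y) ≡ true → fwd? (order y z) ≡ true → fwd? (order x z) ≡ true
  chain x<y y<z = trans (sym (fwd?-order x z))
    (dec-true (x Fin.<? z) (Fin.<-trans {i = x} {j = y} {k = z} (lift x y x<y) (lift y z y<z)))

-- Each 3-set gives six ordered triples of equal weight, and triples with a repeated vertex can only
-- add to the right-hand side.
6badTriples≤∑-weight : ∀ {n} (G : OrientedGraph n) → + 6 ℤ.* + badTriples G ℤ.≤ ∑-weight (arc G)
6badTriples≤∑-weight G = begin
  + 6 ℤ.* + badTriples G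
    ≡⟨ cong (+ 6 ℤ.*_) (trans (badTriples-∑ G) (∑₃-cong (increasing₂≡increasing₃ (arc G)))) ⟩
  + 6 ℤ.* ∑₃ (increasing₃ order (arc G))
    ≡⟨ ∑₃-symmetrise₃ (increasing₃ order (arc G)) ⟨
  ∑₃ (symmetrise₃ (increasing₃ order (arc G)))
    ≤⟨ ∑₃-mono (increasing≤weight order (arc G) order-rev (arc-rev G)) ⟩
  ∑-weight (arc G) ∎
  where open ℤ.≤-Reasoning

∑-tie : ∀ {n} (x : Fin n) → ∑[ y < n ] tie (order x y) ≡ 1ℤ
∑-tie {suc n} 0F          = cong (ℤ._+_ 1ℤ) (sum-replicate-zero n)
-- The term at `0F` vanishes, and `order` on two successors computes to `order` on their
-- predecessors.
∑-tie {suc n} (Fin.suc x) = trans (ℤ.+-identityˡ _) (∑-tie x)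

∑₃-ties : ∀ n → ∑₃ {n} (λ x y z → tie (order x y) ℤ.+ tie (order y z) ℤ.+ tie (order x z)) ≡
  + 3 ℤ.* (+ n ℤ.* + n)
∑₃-ties n = begin
  ∑₃ {n} (λ x y z → tie (order x y) ℤ.+ tie (order y z) ℤ.+ tie (order x z))
    ≡⟨ trans (∑₃-+ {n} (λ x y z → tie (order x y) ℤ.+ tie (order y z)) (λ x y z → tie (order x z)))
         (cong (ℤ._+ ∑₃ {n} (λ x y z → tie (order x z)))
           (∑₃-+ {n} (λ x y z → tie (order x y)) (λ x y z → tie (order y z)))) ⟩
  ∑₃ {n} (λ x y z → tie (order x y)) ℤ.+ ∑₃ {n} (λ x y z → tie (order y z))
    ℤ.+ ∑₃ {n} (λ x y z → tie (order x z))
    ≡⟨ cong₂ ℤ._+_ (cong₂ ℤ._+_ xy yz) xz ⟩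
  + n ℤ.* + n ℤ.+ + n ℤ.* + n ℤ.+ + n ℤ.* + n
    ≡⟨ collect (+ n) ⟩
  + 3 ℤ.* (+ n ℤ.* + n) ∎
  where
  open ≡-Reasoning
  collect : ∀ m → m ℤ.* m ℤ.+ m ℤ.* m ℤ.+ m ℤ.* m ≡ + 3 ℤ.* (m ℤ.* m)
  collect = solve-∀
  n² : ∑[ x < n ] ∑[ y < n ] 1ℤ ≡ + n ℤ.* + n
  n² = trans (∑-const n (∑[ y < n ] 1ℤ)) (cong (+ n ℤ.*_) (trans (∑-const n 1ℤ) (ℤ.*-identityʳ (+ n))))
  yz : ∑₃ {n} (λ x y z → tie (order y z)) ≡ + n ℤ.* + n
  yz = trans (sum-cong-≗ {n} λ x → sum-cong-≗ {n} ∑-tie) n²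
  xz : ∑₃ {n} (λ x y z → tie (order x z)) ≡ + n ℤ.* + n
  xz = trans (sum-cong-≗ {n} λ x → sum-cong-≗ {n} λ y → ∑-tie x) n²
  xy : ∑₃ {n} (λ x y z → tie (order x y)) ≡ + n ℤ.* + n
  xy = trans (sym (∑₃-τ₂ {n} λ x y z → tie (order x y))) xz

-- The error pays for ordered triples with a repeated vertex: each of the three pairs of positions
-- coincides in n² triples.
∑-weight≤6badTriples : ∀ {n} (G : OrientedGraph n) →
  ∑-weight (arc G) ℤ.≤ + 6 ℤ.* + badTriples G ℤ.+ + 3 ℤ.* (+ n ℤ.* + n)
∑-weight≤6badTriples {n} G = begin
  ∑-weight (arc G)
    ≤⟨ ∑₃-mono (weight≤increasing order (arc G) order-rev (arc-rev G)) ⟩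
  ∑₃ (λ x y z → symmetrise₃ (increasing₂ order (arc G)) x y z ℤ.+ ties x y z)
    ≡⟨ ∑₃-+ (symmetrise₃ (increasing₂ order (arc G))) ties ⟩
  ∑₃ (symmetrise₃ (increasing₂ order (arc G))) ℤ.+ ∑₃ ties
    ≡⟨ cong₂ ℤ._+_ (∑₃-symmetrise₃ (increasing₂ order (arc G))) (∑₃-ties n) ⟩
  + 6 ℤ.* ∑₃ (increasing₂ order (arc G)) ℤ.+ + 3 ℤ.* (+ n ℤ.* + n)
    ≡⟨ cong (λ s → + 6 ℤ.* s ℤ.+ + 3 ℤ.* (+ n ℤ.* + n)) (badTriples-∑ G) ⟨
  + 6 ℤ.* + badTriples G ℤ.+ + 3 ℤ.* (+ n ℤ.* + n) ∎
  where
  open ℤ.≤-Reasoning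
  ties : Fin n → Fin n → Fin n → ℤ
  ties x y z = tie (order x y) ℤ.+ tie (order y z) ℤ.+ tie (order x z)

n³≤54badTriples+27n² : ∀ {n} (G : OrientedGraph n) →
  n ℕ.* (n ℕ.* n) ℕ.≤ 54 ℕ.* badTriples G ℕ.+ 27 ℕ.* (n ℕ.* n)
n³≤54badTriples+27n² {n} G = ℤ.drop‿+≤+ (begin
  + (n ℕ.* (n ℕ.* n))
    ≡⟨ trans (ℤ.pos-* n (n ℕ.* n)) (cong (+ n ℤ.*_) (ℤ.pos-* n n)) ⟩
  + n ℤ.* (+ n ℤ.* + n)
    ≤⟨ n³≤9∑-weight (arc G) (arc-rev G) ⟩
  + 9 ℤ.* ∑-weight (arc G)
    ≤⟨ ℤ.*-monoˡ-≤-nonNeg (+ 9) (∑-weight≤6badTriples G) ⟩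
  + 9 ℤ.* (+ 6 ℤ.* + badTriples G ℤ.+ + 3 ℤ.* (+ n ℤ.* + n))
    ≡⟨ distribute (+ badTriples G) (+ n ℤ.* + n) ⟩
  + 54 ℤ.* + badTriples G ℤ.+ + 27 ℤ.* (+ n ℤ.* + n)
    ≡⟨ cong₂ ℤ._+_ (ℤ.pos-* 54 (badTriples G))
         (trans (ℤ.pos-* 27 (n ℕ.* n)) (cong (+ 27 ℤ.*_) (ℤ.pos-* n n))) ⟨
  + (54 ℕ.* badTriples G) ℤ.+ + (27 ℕ.* (n ℕ.* n))
    ≡⟨ ℤ.pos-+ (54 ℕ.* badTriples G) (27 ℕ.* (n ℕ.* n)) ⟨
  + (54 ℕ.* badTriples G ℕ.+ 27 ℕ.* (n ℕ.* n)) ∎)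
  where
  open ℤ.≤-Reasoning
  distribute : ∀ b s → + 9 ℤ.* (+ 6 ℤ.* b ℤ.+ + 3 ℤ.* s) ≡ + 54 ℤ.* b ℤ.+ + 27 ℤ.* s
  distribute = solve-∀

-- The balanced blow-up of the directed triangle

-- Residues modulo 3 balance the classes, and the recursion by three lets `∑-same` peel off one
-- vertex of each colour at a time.
colour : ℕ → Fin 3
colour 0                   = 0F
colour 1                   = 1F
colour 2                   = 2F
colour (suc (suc (suc m))) = colour m

next : Fin 3 → Fin 3
next 0F = 1F
next 1F = 2F
next 2F = 0F

blowUpC₃ : ∀ n → OrientedGraph n
blowUpC₃ n = record
  { E        = λ x y → does (next (colour (Fin.toℕ x)) Fin.≟ colour (Fin.toℕ y))
  ; noLoop   = λ x → loopless (colour (Fin.toℕ x))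
  ; oriented = λ x y → antiparallel (colour (Fin.toℕ x)) (colour (Fin.toℕ y))
  }
  where
  loopless : ∀ p → does (next p Fin.≟ p) ≡ false
  loopless 0F = refl
  loopless 1F = refl
  loopless 2F = refl
  antiparallel : ∀ p q → does (next p Fin.≟ q) ≡ true → does (next q Fin.≟ p) ≡ false
  antiparallel 0F 1F _ = refl
  antiparallel 1F 2F _ = refl
  antiparallel 2F 0F _ = refl

same : Fin 3 → Fin 3 → ℤ
same p q = χ (does (p Fin.≟ q))

-- A class has at most ⌈n/3⌉ ≤ (n + 2)/3 vertices.
∑-same : ∀ n p → + 3 ℤ.* ∑[ x < n ] same p (colour (Fin.toℕ x)) ℤ.≤ + n ℤ.+ + 2
∑-same 0 p = ℤ.+≤+ ℕ.z≤n
∑-same 1 p = from-yes (Fin.all? λ p → + 3 ℤ.* (same p 0F ℤ.+ 0ℤ) ℤ.≤? + 3) p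
∑-same 2 p = from-yes (Fin.all? λ p → + 3 ℤ.* (same p 0F ℤ.+ (same p 1F ℤ.+ 0ℤ)) ℤ.≤? + 4) p
∑-same (suc (suc (suc n))) p = begin
  + 3 ℤ.* (same p 0F ℤ.+ (same p 1F ℤ.+ (same p 2F ℤ.+ s)))
    ≡⟨ cong (+ 3 ℤ.*_) (trans (regroup (same p 0F) (same p 1F) (same p 2F) s) (cong (ℤ._+ s) (one-of-three p))) ⟩
  + 3 ℤ.* (1ℤ ℤ.+ s)
    ≡⟨ ℤ.*-distribˡ-+ (+ 3) 1ℤ s ⟩
  + 3 ℤ.+ + 3 ℤ.* s
    ≤⟨ ℤ.+-monoʳ-≤ (+ 3) (∑-same n p) ⟩
  + (3 ℕ.+ n) ℤ.+ + 2 ∎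
  where
  open ℤ.≤-Reasoning
  s = ∑[ x < n ] same p (colour (Fin.toℕ x))
  regroup : ∀ a b c s → a ℤ.+ (b ℤ.+ (c ℤ.+ s)) ≡ a ℤ.+ b ℤ.+ c ℤ.+ s
  regroup = solve-∀
  one-of-three : ∀ p → same p 0F ℤ.+ same p 1F ℤ.+ same p 2F ≡ 1ℤ
  one-of-three 0F = refl
  one-of-three 1F = refl
  one-of-three 2F = refl

-- A transitive or independent triple lies in one class: three different classes give a directed
-- triangle, and exactly two classes give exactly two arcs.
weight-blowUpC₃ : ∀ p q s → let e = λ u v → arcOf (does (next u Fin.≟ v)) (does (next v Fin.≟ u)) in
  weight (e p q) (e q s) (e p s) ℤ.≤ same p q ℤ.* same p s
weight-blowUpC₃ = from-yes (Fin.all? λ p → Fin.all? λ q → Fin.all? λ s →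
  let e = λ u v → arcOf (does (next u Fin.≟ v)) (does (next v Fin.≟ u)) in
  weight (e p q) (e q s) (e p s) ℤ.≤? same p q ℤ.* same p s)

-- For fixed `x` the bound by `same` factors over `y` and `z` into the square of the size of the
-- class of `x`. The 9 is split as 3 · 3 to apply `∑-same` to each factor.
9∑-weight-blowUpC₃ : ∀ n → + 9 ℤ.* ∑-weight (arc (blowUpC₃ n)) ℤ.≤ + n ℤ.* ((+ n ℤ.+ + 2) ℤ.* (+ n ℤ.+ + 2))
9∑-weight-blowUpC₃ n = begin
  + 9 ℤ.* ∑-weight (arc (blowUpC₃ n))
    ≤⟨ ℤ.*-monoˡ-≤-nonNeg (+ 9) (∑₃-mono λ x y z → weight-blowUpC₃ (c x) (c y) (c z)) ⟩
  + 9 ℤ.* ∑₃ (λ x y z → same (c x) (c y) ℤ.* same (c x) (c z))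
    ≡⟨ cong (+ 9 ℤ.*_) (sum-cong-≗ λ x → trans (*-distribʳ-sum (class x) (λ y → same (c x) (c y)))
         (sum-cong-≗ λ y → *-distribˡ-sum (same (c x) (c y)) (λ z → same (c x) (c z)))) ⟨
  + 9 ℤ.* ∑[ x < n ] (class x ℤ.* class x)
    ≡⟨ trans (*-distribˡ-sum (+ 9) (λ x → class x ℤ.* class x)) (sum-cong-≗ λ x → square (class x)) ⟩
  ∑[ x < n ] ((+ 3 ℤ.* class x) ℤ.* (+ 3 ℤ.* class x))
    ≤⟨ ∑-mono (λ x → ℤ.≤-trans
         (ℤ.*-monoˡ-≤-nonNeg (+ 3 ℤ.* class x) {{ℤ.nonNegative (0≤3class x)}} (∑-same n (c x)))
         (ℤ.*-monoʳ-≤-nonNeg (+ n ℤ.+ + 2) (∑-same n (c x)))) ⟩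
  ∑[ x < n ] ((+ n ℤ.+ + 2) ℤ.* (+ n ℤ.+ + 2))
    ≡⟨ ∑-const n ((+ n ℤ.+ + 2) ℤ.* (+ n ℤ.+ + 2)) ⟩
  + n ℤ.* ((+ n ℤ.+ + 2) ℤ.* (+ n ℤ.+ + 2)) ∎
  where
  open ℤ.≤-Reasoning
  c : Fin n → Fin 3
  c = colour ∘ Fin.toℕ
  class : Fin n → ℤ
  class x = ∑[ y < n ] same (c x) (c y)
  square : ∀ s → + 9 ℤ.* (s ℤ.* s) ≡ (+ 3 ℤ.* s) ℤ.* (+ 3 ℤ.* s)
  square = solve-∀
  0≤χ : ∀ b → 0ℤ ℤ.≤ χ b
  0≤χ true  = ℤ.+≤+ ℕ.z≤n
  0≤χ false = ℤ.+≤+ ℕ.z≤n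
  0≤3class : ∀ x → 0ℤ ℤ.≤ + 3 ℤ.* class x
  0≤3class x = ℤ.*-monoˡ-≤-nonNeg (+ 3) (∑-nonneg λ y → 0≤χ (does (c x Fin.≟ c y)))

54badTriples-blowUpC₃ : ∀ n → 54 ℕ.* badTriples (blowUpC₃ n) ℕ.≤ n ℕ.* ((n ℕ.+ 2) ℕ.* (n ℕ.+ 2))
54badTriples-blowUpC₃ n = ℤ.drop‿+≤+ (begin
  + (54 ℕ.* b)
    ≡⟨ trans (ℤ.pos-* 54 b) (ℤ.*-assoc (+ 9) (+ 6) (+ b)) ⟩
  + 9 ℤ.* (+ 6 ℤ.* + b)
    ≤⟨ ℤ.*-monoˡ-≤-nonNeg (+ 9) (6badTriples≤∑-weight (blowUpC₃ n)) ⟩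
  + 9 ℤ.* ∑-weight (arc (blowUpC₃ n))
    ≤⟨ 9∑-weight-blowUpC₃ n ⟩
  + n ℤ.* (+ (n ℕ.+ 2) ℤ.* + (n ℕ.+ 2))
    ≡⟨ trans (ℤ.pos-* n _) (cong (+ n ℤ.*_) (ℤ.pos-* (n ℕ.+ 2) (n ℕ.+ 2))) ⟨
  + (n ℕ.* ((n ℕ.+ 2) ℕ.* (n ℕ.+ 2))) ∎)
  where
  open ℤ.≤-Reasoning
  b = badTriples (blowUpC₃ n)

-- Asymptotics

2*[1+m]C2 : ∀ m → 2 ℕ.* (suc m C 2) ≡ suc m ℕ.* m
2*[1+m]C2 zero    = refl
2*[1+m]C2 (suc m) = begin
  2 ℕ.* (suc (suc m) C 2)
    ≡⟨ cong (2 ℕ.*_) (ℕ.nCk+nC[k+1]≡[n+1]C[k+1] (suc m) 1) ⟨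
  2 ℕ.* (suc m C 1 ℕ.+ suc m C 2)
    ≡⟨ ℕ.*-distribˡ-+ 2 (suc m C 1) (suc m C 2) ⟩
  2 ℕ.* (suc m C 1) ℕ.+ 2 ℕ.* (suc m C 2)
    ≡⟨ cong₂ (λ u v → 2 ℕ.* u ℕ.+ v) (ℕ.nC1≡n (suc m)) (2*[1+m]C2 m) ⟩
  2 ℕ.* suc m ℕ.+ suc m ℕ.* m
    ≡⟨ factor m ⟩
  suc (suc m) ℕ.* suc m ∎
  where
  open ≡-Reasoning
  factor : ∀ m → 2 ℕ.* suc m ℕ.+ suc m ℕ.* m ≡ suc (suc m) ℕ.* suc m
  factor = solveℕ-∀

-- Pascal's rule and induction. Starting from `suc (suc m)` writes the falling factorial without
-- subtraction.
6*[2+m]C3 : ∀ m → 6 ℕ.* (suc (suc m) C 3) ≡ suc (suc m) ℕ.* (suc m ℕ.* m)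
6*[2+m]C3 zero    = refl
6*[2+m]C3 (suc m) = begin
  6 ℕ.* (suc (suc (suc m)) C 3)
    ≡⟨ cong (6 ℕ.*_) (ℕ.nCk+nC[k+1]≡[n+1]C[k+1] (suc (suc m)) 2) ⟨
  6 ℕ.* (suc (suc m) C 2 ℕ.+ suc (suc m) C 3)
    ≡⟨ expand (suc (suc m) C 2) (suc (suc m) C 3) ⟩
  3 ℕ.* (2 ℕ.* (suc (suc m) C 2)) ℕ.+ 6 ℕ.* (suc (suc m) C 3)
    ≡⟨ cong₂ (λ u v → 3 ℕ.* u ℕ.+ v) (2*[1+m]C2 (suc m)) (6*[2+m]C3 m) ⟩
  3 ℕ.* (suc (suc m) ℕ.* suc m) ℕ.+ suc (suc m) ℕ.* (suc m ℕ.* m)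
    ≡⟨ factor m ⟩
  suc (suc (suc m)) ℕ.* (suc (suc m) ℕ.* suc m) ∎
  where
  open ≡-Reasoning
  expand : ∀ u v → 6 ℕ.* (u ℕ.+ v) ≡ 3 ℕ.* (2 ℕ.* u) ℕ.+ 6 ℕ.* v
  expand = solveℕ-∀
  factor : ∀ m → 3 ℕ.* (suc (suc m) ℕ.* suc m) ℕ.+ suc (suc m) ℕ.* (suc m ℕ.* m) ≡
                 suc (suc (suc m)) ℕ.* (suc (suc m) ℕ.* suc m)
  factor = solveℕ-∀

6*nC3≤n³ : ∀ {n} → 3 ≤ n → 6 ℕ.* (n C 3) ≤ n ℕ.* (n ℕ.* n)
6*nC3≤n³ {suc (suc m)} _ = begin
  6 ℕ.* (suc (suc m) C 3)                   ≡⟨ 6*[2+m]C3 m ⟩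
  suc (suc m) ℕ.* (suc m ℕ.* m)             ≤⟨ ℕ.*-monoʳ-≤ (suc (suc m)) (ℕ.*-mono-≤ (ℕ.n≤1+n (suc m)) (ℕ.m≤n+m m 2)) ⟩
  suc (suc m) ℕ.* (suc (suc m) ℕ.* suc (suc m)) ∎
  where open ℕ.≤-Reasoning
6*nC3≤n³ {1} (ℕ.s≤s ())

-- This shows that an error of order n² is negligible against `n C 3`. With n = m + 3, the slack 9(m
-- + 2)(m + 1) - 2(m + 3)² is 7m² + 15m; equality holds at n = 3.
2n³≤54*nC3 : ∀ {n} → 3 ≤ n → 2 ℕ.* (n ℕ.* (n ℕ.* n)) ≤ 54 ℕ.* (n C 3)
2n³≤54*nC3 (ℕ.s≤s (ℕ.s≤s (ℕ.s≤s {n = m} _))) = begin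
  2 ℕ.* (n ℕ.* (n ℕ.* n))                               ≤⟨ ℕ.m≤m+n _ (n ℕ.* (7 ℕ.* (m ℕ.* m) ℕ.+ 15 ℕ.* m)) ⟩
  2 ℕ.* (n ℕ.* (n ℕ.* n)) ℕ.+ n ℕ.* (7 ℕ.* (m ℕ.* m) ℕ.+ 15 ℕ.* m)
                                                        ≡⟨ regroup m ⟩
  9 ℕ.* (n ℕ.* (suc (suc m) ℕ.* suc m))                 ≡⟨ cong (9 ℕ.*_) (6*[2+m]C3 (suc m)) ⟨
  9 ℕ.* (6 ℕ.* (n C 3))                                 ≡⟨ ℕ.*-assoc 9 6 (n C 3) ⟨
  54 ℕ.* (n C 3)                                        ∎
  where
  open ℕ.≤-Reasoning
  n = suc (suc (suc m))
  regroup : ∀ m → let n = suc (suc (suc m)) in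
    2 ℕ.* (n ℕ.* (n ℕ.* n)) ℕ.+ n ℕ.* (7 ℕ.* (m ℕ.* m) ℕ.+ 15 ℕ.* m) ≡
    9 ℕ.* (n ℕ.* (suc (suc m) ℕ.* suc m))
  regroup = solveℕ-∀

-- The true excess over `6 ℕ.* (n C 3)` is 7n² + 2n. It is rounded up to the error 27n² of the lower
-- bound, so that `27n²q≤54pd` serves both directions.
n[n+2]²≤6*nC3+27n² : ∀ {n} → 3 ≤ n → n ℕ.* ((n ℕ.+ 2) ℕ.* (n ℕ.+ 2)) ≤ 6 ℕ.* (n C 3) ℕ.+ 27 ℕ.* (n ℕ.* n)
n[n+2]²≤6*nC3+27n² (ℕ.s≤s (ℕ.s≤s (ℕ.s≤s {n = m} _))) = begin
  n ℕ.* ((n ℕ.+ 2) ℕ.* (n ℕ.+ 2))                                 ≤⟨ ℕ.m≤m+n _ (n ℕ.* (20 ℕ.* m ℕ.+ 58)) ⟩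
  n ℕ.* ((n ℕ.+ 2) ℕ.* (n ℕ.+ 2)) ℕ.+ n ℕ.* (20 ℕ.* m ℕ.+ 58)     ≡⟨ regroup m ⟩
  n ℕ.* (suc (suc m) ℕ.* suc m) ℕ.+ 27 ℕ.* (n ℕ.* n)              ≡⟨ cong (ℕ._+ 27 ℕ.* (n ℕ.* n)) (6*[2+m]C3 (suc m)) ⟨
  6 ℕ.* (n C 3) ℕ.+ 27 ℕ.* (n ℕ.* n)                              ∎
  where
  open ℕ.≤-Reasoning
  n = suc (suc (suc m))
  regroup : ∀ m → let n = suc (suc (suc m)) in
    n ℕ.* ((n ℕ.+ 2) ℕ.* (n ℕ.+ 2)) ℕ.+ n ℕ.* (20 ℕ.* m ℕ.+ 58) ≡
    n ℕ.* (suc (suc m) ℕ.* suc m) ℕ.+ 27 ℕ.* (n ℕ.* n)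
  regroup = solveℕ-∀

-- Comparing rationals by cross-multiplication

ratio-+ : ∀ a b d → ratio a d + ratio b d ≡ ratio (a ℕ.+ b) d
ratio-+ a b zero    = refl
ratio-+ a b (suc d) = ℚ.toℚᵘ-injective (begin
  ℚ.toℚᵘ (ratio a (suc d) + ratio b (suc d))
    ≈⟨ ℚ.toℚᵘ-homo-+ (ratio a (suc d)) (ratio b (suc d)) ⟩
  ℚ.toℚᵘ (ratio a (suc d)) ℚᵘ.+ ℚ.toℚᵘ (ratio b (suc d))
    ≈⟨ ℚᵘ.+-cong (ℚ.toℚᵘ-fromℚᵘ (mkℚᵘ (+ a) d)) (ℚ.toℚᵘ-fromℚᵘ (mkℚᵘ (+ b) d)) ⟩
  mkℚᵘ (+ a) d ℚᵘ.+ mkℚᵘ (+ b) d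
    ≈⟨ *≡* (crossMultiply (+ a) (+ b) (+ suc d)) ⟩
  mkℚᵘ (+ (a ℕ.+ b)) d
    ≈⟨ ℚ.toℚᵘ-fromℚᵘ (mkℚᵘ (+ (a ℕ.+ b)) d) ⟨
  ℚ.toℚᵘ (ratio (a ℕ.+ b) (suc d)) ∎)
  where
  open ℚᵘ.≃-Reasoning
  crossMultiply : ∀ a b d → (a ℤ.* d ℤ.+ b ℤ.* d) ℤ.* d ≡ (a ℤ.+ b) ℤ.* (d ℤ.* d)
  crossMultiply = solve-∀

p≤q+r⇒p-r≤q : ∀ {p q r} → p ≤ℚ q + r → p - r ≤ℚ q
p≤q+r⇒p-r≤q {p} {q} {r} p≤q+r = begin
  p - r         ≤⟨ ℚ.+-monoˡ-≤ (ℚ.- r) p≤q+r ⟩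
  q + r - r     ≡⟨ ℚ.+-assoc q r (ℚ.- r) ⟩
  q + (r - r)   ≡⟨ cong (ℚ._+_ q) (ℚ.+-inverseʳ r) ⟩
  q + 0ℚ        ≡⟨ ℚ.+-identityʳ q ⟩
  q             ∎
  where open ℚ.≤-Reasoning

toℚᵘ-ratio : ∀ b d → ℚ.toℚᵘ (ratio b (suc d)) ℚᵘ.≃ mkℚᵘ (+ b) d
toℚᵘ-ratio b d = ℚ.toℚᵘ-fromℚᵘ (mkℚᵘ (+ b) d)

pos-*-+-* : ∀ a b c d → + (a ℕ.* b ℕ.+ c ℕ.* d) ≡ + a ℤ.* + b ℤ.+ + c ℤ.* + d
pos-*-+-* a b c d = cong₂ ℤ._+_ (ℤ.pos-* a b) (ℤ.pos-* c d)

one-ninth≤ratio+ε : ∀ {b d p q} .(c : Coprime p (suc q)) →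
  suc d ℕ.* suc q ≤ 9 ℕ.* (b ℕ.* suc q ℕ.+ p ℕ.* suc d) → one-ninth ≤ℚ ratio b (suc d) + ℚ.mkℚ (+ p) q c
one-ninth≤ratio+ε {b} {d} {p} {q} c bound = ℚ.toℚᵘ-cancel-≤ (begin
  mkℚᵘ (+ 1) 8
    ≤⟨ *≤* cross ⟩
  mkℚᵘ (+ b) d ℚᵘ.+ mkℚᵘ (+ p) q
    ≃⟨ ℚᵘ.+-congˡ (mkℚᵘ (+ p) q) (toℚᵘ-ratio b d) ⟨
  ℚ.toℚᵘ (ratio b (suc d)) ℚᵘ.+ ℚ.toℚᵘ ε
    ≃⟨ ℚ.toℚᵘ-homo-+ (ratio b (suc d)) ε ⟨
  ℚ.toℚᵘ (ratio b (suc d) + ε) ∎)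
  where
  ε = ℚ.mkℚ (+ p) q c
  open ℚᵘ.≤-Reasoning
  cross : 1ℤ ℤ.* + (suc d ℕ.* suc q) ℤ.≤ (+ b ℤ.* + suc q ℤ.+ + p ℤ.* + suc d) ℤ.* + 9
  cross = subst₂ ℤ._≤_ (sym (ℤ.*-identityˡ (+ (suc d ℕ.* suc q))))
    (trans (cong +_ (ℕ.*-comm 9 (b ℕ.* suc q ℕ.+ p ℕ.* suc d)))
    (trans (ℤ.pos-* (b ℕ.* suc q ℕ.+ p ℕ.* suc d) 9) (cong (ℤ._* + 9) (pos-*-+-* b (suc q) p (suc d)))))
    (ℤ.+≤+ bound)

-- The factor `1 ℕ.*` is kept so that `bound` has the shape of the numerator of the unnormalised sum
-- 1/9 + ε.
ratio≤one-ninth+ε : ∀ {b d p q} .(c : Coprime p (suc q)) →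
  b ℕ.* (9 ℕ.* suc q) ≤ (1 ℕ.* suc q ℕ.+ p ℕ.* 9) ℕ.* suc d → ratio b (suc d) ≤ℚ one-ninth + ℚ.mkℚ (+ p) q c
ratio≤one-ninth+ε {b} {d} {p} {q} c bound = ℚ.toℚᵘ-cancel-≤ (begin
  ℚ.toℚᵘ (ratio b (suc d))
    ≃⟨ toℚᵘ-ratio b d ⟩
  mkℚᵘ (+ b) d
    ≤⟨ *≤* cross ⟩
  mkℚᵘ (+ 1) 8 ℚᵘ.+ mkℚᵘ (+ p) q
    ≃⟨ ℚ.toℚᵘ-homo-+ one-ninth ε ⟨
  ℚ.toℚᵘ (one-ninth + ε) ∎)
  where
  ε = ℚ.mkℚ (+ p) q c
  open ℚᵘ.≤-Reasoning
  cross : + b ℤ.* + (9 ℕ.* suc q) ℤ.≤ (+ 1 ℤ.* + suc q ℤ.+ + p ℤ.* + 9) ℤ.* + suc d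
  cross = subst₂ ℤ._≤_ (ℤ.pos-* b (9 ℕ.* suc q))
    (trans (ℤ.pos-* (1 ℕ.* suc q ℕ.+ p ℕ.* 9) (suc d)) (cong (ℤ._* + suc d) (pos-*-+-* 1 (suc q) p 9)))
    (ℤ.+≤+ bound)

-- This is where the threshold 14q comes from: 27 is rounded up to 28 = 2 · 14, one factor `n`
-- absorbs `14 ℕ.* q`, and 2n³ is then bounded by `54 ℕ.* d`.
27n²q≤54pd : ∀ n q d p → 14 ℕ.* q ≤ n → 2 ℕ.* (n ℕ.* (n ℕ.* n)) ≤ 54 ℕ.* d →
  27 ℕ.* (n ℕ.* n) ℕ.* q ≤ 54 ℕ.* (suc p ℕ.* d)
27n²q≤54pd n q d p 14q≤n 2n³≤54d = begin
  27 ℕ.* (n ℕ.* n) ℕ.* q          ≤⟨ ℕ.*-monoˡ-≤ q (ℕ.*-monoˡ-≤ (n ℕ.* n) (ℕ.n≤1+n 27)) ⟩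
  28 ℕ.* (n ℕ.* n) ℕ.* q          ≡⟨ regroup n q ⟩
  2 ℕ.* (14 ℕ.* q ℕ.* (n ℕ.* n))  ≤⟨ ℕ.*-monoʳ-≤ 2 (ℕ.*-monoˡ-≤ (n ℕ.* n) 14q≤n) ⟩
  2 ℕ.* (n ℕ.* (n ℕ.* n))         ≤⟨ 2n³≤54d ⟩
  54 ℕ.* d                        ≤⟨ ℕ.*-monoʳ-≤ 54 (ℕ.m≤n*m d (suc p)) ⟩
  54 ℕ.* (suc p ℕ.* d)            ∎
  where
  open ℕ.≤-Reasoning
  regroup : ∀ n q → 28 ℕ.* (n ℕ.* n) ℕ.* q ≡ 2 ℕ.* (14 ℕ.* q ℕ.* (n ℕ.* n))
  regroup = solveℕ-∀

crossed-lower : ∀ n b d p q → 6 ℕ.* d ≤ 54 ℕ.* b ℕ.+ 27 ℕ.* (n ℕ.* n) →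
  27 ℕ.* (n ℕ.* n) ℕ.* q ≤ 54 ℕ.* (p ℕ.* d) → d ℕ.* q ≤ 9 ℕ.* (b ℕ.* q ℕ.+ p ℕ.* d)
crossed-lower n b d p q 6d≤ error = ℕ.*-cancelˡ-≤ 6 (begin
  6 ℕ.* (d ℕ.* q)                                     ≡⟨ ℕ.*-assoc 6 d q ⟨
  6 ℕ.* d ℕ.* q                                       ≤⟨ ℕ.*-monoˡ-≤ q 6d≤ ⟩
  (54 ℕ.* b ℕ.+ 27 ℕ.* (n ℕ.* n)) ℕ.* q               ≡⟨ ℕ.*-distribʳ-+ q (54 ℕ.* b) _ ⟩
  54 ℕ.* b ℕ.* q ℕ.+ 27 ℕ.* (n ℕ.* n) ℕ.* q           ≤⟨ ℕ.+-monoʳ-≤ (54 ℕ.* b ℕ.* q) error ⟩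
  54 ℕ.* b ℕ.* q ℕ.+ 54 ℕ.* (p ℕ.* d)                 ≡⟨ regroup b q (p ℕ.* d) ⟩
  6 ℕ.* (9 ℕ.* (b ℕ.* q ℕ.+ p ℕ.* d))                 ∎)
  where
  open ℕ.≤-Reasoning
  regroup : ∀ b q s → 54 ℕ.* b ℕ.* q ℕ.+ 54 ℕ.* s ≡ 6 ℕ.* (9 ℕ.* (b ℕ.* q ℕ.+ s))
  regroup = solveℕ-∀

crossed-upper : ∀ n b d p q → 54 ℕ.* b ≤ 6 ℕ.* d ℕ.+ 27 ℕ.* (n ℕ.* n) →
  27 ℕ.* (n ℕ.* n) ℕ.* q ≤ 54 ℕ.* (p ℕ.* d) → b ℕ.* (9 ℕ.* q) ≤ (1 ℕ.* q ℕ.+ p ℕ.* 9) ℕ.* d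
crossed-upper n b d p q 54b≤ error = ℕ.*-cancelˡ-≤ 6 (begin
  6 ℕ.* (b ℕ.* (9 ℕ.* q))                             ≡⟨ assoc b q ⟩
  54 ℕ.* b ℕ.* q                                      ≤⟨ ℕ.*-monoˡ-≤ q 54b≤ ⟩
  (6 ℕ.* d ℕ.+ 27 ℕ.* (n ℕ.* n)) ℕ.* q                ≡⟨ ℕ.*-distribʳ-+ q (6 ℕ.* d) _ ⟩
  6 ℕ.* d ℕ.* q ℕ.+ 27 ℕ.* (n ℕ.* n) ℕ.* q            ≤⟨ ℕ.+-monoʳ-≤ (6 ℕ.* d ℕ.* q) error ⟩
  6 ℕ.* d ℕ.* q ℕ.+ 54 ℕ.* (p ℕ.* d)                  ≡⟨ regroup d q p ⟩
  6 ℕ.* ((1 ℕ.* q ℕ.+ p ℕ.* 9) ℕ.* d)                 ∎)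
  where
  open ℕ.≤-Reasoning
  assoc : ∀ b q → 6 ℕ.* (b ℕ.* (9 ℕ.* q)) ≡ 54 ℕ.* b ℕ.* q
  assoc = solveℕ-∀
  regroup : ∀ d q p → 6 ℕ.* d ℕ.* q ℕ.+ 54 ℕ.* (p ℕ.* d) ≡ 6 ℕ.* ((1 ℕ.* q ℕ.+ p ℕ.* 9) ℕ.* d)
  regroup = solveℕ-∀

t+i : ∀ {n} (G : OrientedGraph n) → t G + i G ≡ ratio (badTriples G) (n C 3)
t+i {n} G = ratio-+ (length (filter (λ s → isTransitive G s Bool.≟ true) (threeSets n))) _ (n C 3)

theorem1p2 : (ε : ℚ) → 0ℚ < ε →
    ∃[ N ] ((n : ℕ) → 3 ≤ n → N ≤ n →
    ((G : OrientedGraph n) → one-ninth - ε ≤ℚ t G + i G)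
    × (∃[ G ] (t {n} G + i G ≤ℚ one-ninth + ε)))
theorem1p2 ε@(ℚ.mkℚ (+ zero) q _) (ℚ.*<* (ℤ.+<+ ()))
theorem1p2 ε@(ℚ.mkℚ (ℤ.-[1+ p ]) q _) (ℚ.*<* ())
-- The number `n C 3` is passed as a variable with an equation, so that it can be matched as a
-- successor and `ratio` computes.
theorem1p2 ε@(ℚ.mkℚ (+ suc p) q c) _ = 14 ℕ.* suc q , λ n 3≤n N≤n → bounds n 3≤n N≤n (n C 3) refl
  where
  bounds : ∀ n → 3 ≤ n → 14 ℕ.* suc q ≤ n → ∀ d → n C 3 ≡ d →
    ((G : OrientedGraph n) → one-ninth - ε ≤ℚ t G + i G) × (∃[ G ] (t {n} G + i G ≤ℚ one-ninth + ε))
  -- If `n C 3` were zero, the positive number 2n³ would be at most 0.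
  bounds n@(suc _) 3≤n N≤n zero nC3≡0 with () ← subst (λ d → 2 ℕ.* (n ℕ.* (n ℕ.* n)) ≤ 54 ℕ.* d) nC3≡0 (2n³≤54*nC3 3≤n)
  bounds n 3≤n N≤n d@(suc d-1) nC3≡d = lower , blowUpC₃ n , upper
    where
    error : 27 ℕ.* (n ℕ.* n) ℕ.* suc q ≤ 54 ℕ.* (suc p ℕ.* d)
    error = 27n²q≤54pd n (suc q) d p N≤n
      (subst (λ d → 2 ℕ.* (n ℕ.* (n ℕ.* n)) ≤ 54 ℕ.* d) nC3≡d (2n³≤54*nC3 3≤n))
    lower : (G : OrientedGraph n) → one-ninth - ε ≤ℚ t G + i G
    lower G = subst (one-ninth - ε ≤ℚ_) (sym (trans (t+i G) (cong (ratio (badTriples G)) nC3≡d)))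
      (p≤q+r⇒p-r≤q {one-ninth} {ratio (badTriples G) d} {ε} (one-ninth≤ratio+ε {badTriples G} c
        (crossed-lower n (badTriples G) d (suc p) (suc q)
          (ℕ.≤-trans (subst (λ d → 6 ℕ.* d ≤ n ℕ.* (n ℕ.* n)) nC3≡d (6*nC3≤n³ 3≤n)) (n³≤54badTriples+27n² G))
          error)))
    upper : t (blowUpC₃ n) + i (blowUpC₃ n) ≤ℚ one-ninth + ε
    upper = subst (_≤ℚ one-ninth + ε) (sym (trans (t+i (blowUpC₃ n)) (cong (ratio (badTriples (blowUpC₃ n))) nC3≡d)))
      (ratio≤one-ninth+ε {badTriples (blowUpC₃ n)} c
        (crossed-upper n (badTriples (blowUpC₃ n)) d (suc p) (suc q)
          (ℕ.≤-trans (54badTriples-blowUpC₃ n)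
            (subst (λ d → n ℕ.* ((n ℕ.+ 2) ℕ.* (n ℕ.+ 2)) ≤ 6 ℕ.* d ℕ.+ 27 ℕ.* (n ℕ.* n)) nC3≡d (n[n+2]²≤6*nC3+27n² 3≤n)))
          error))
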